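{- Let $S_1 = (P_r, \sigma_1)$ be a signed path on $r$ vertices, let $S_2 = (C_s, \sigma_2)$ be a signed cycle on $s$ vertices, and let $S = S_1 \square S_2$ be their Cartesian product. If $r > 1$, then $\chi'(S) = \Delta(S)$.
   Context: All graphs are simple, finite and undirected; $P_r$ is the path on $r$ vertices and $C_s$ ($s\ge 3$) the cycle on $s$ vertices. A signed graph is a pair $S=(G,\sigma)$ where $G$ is a graph and $\sigma\colon E(G)\to\{+1,-1\}$; $G$ is the underlying graph. $V(S)$, $E(S)$ and $\Delta(S)$ (maximum degree) refer to the underlying graph. An incidence is a pair $v\text{:}e$ of a vertex $v$ and an edge $e$ having $v$ as an endpoint; $I(G)$ is the set of all incidences. For a positive integer $k$ let $M_k=\{0,\pm1,\ldots,\pm l\}$ if $k=2l+1$ and $M_k=\{\pm1,\ldots,\pm l\}$ if $k=2l$. A $k$-edge-coloring of $S=(G,\sigma)$ is a function $f\colon I(G)\to M_k$ such that $f(u\text{:}uv)=-\sigma(uv)f(v\text{:}uv)$ for each edge $uv$, and $f(u\text{:}uv_1)\neq f(u\text{:}uv_2)$ for any two distinct edges $uv_1\neq uv_2$ at a common vertex $u$. The chromatic index $\chi'(S)$ is the smallest $k$ for which $S$ has a $k$-edge-coloring. The Cartesian product $S_1\square S_2$ of signed graphs $S_1=(G_1,\sigma_1)$, $S_2=(G_2,\sigma_2)$ is the signed graph with vertex set $V(S_1)\times V(S_2)$ in which $(u,u')(v,v')$ is an edge iff either $u=v$ and $u'v'\in E(S_2)$ (the sign is then $\sigma_2(u'v')$),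 or $uv\in E(S_1)$ and $u'=v'$ (the sign is then $\sigma_1(uv)$). -}

module Defs where

open import Data.Empty using (⊥-elim)
open import Data.Fin.Base using (Fin; toℕ)
import Data.Fin.Properties as Fin
open import Data.Integer.Base using (ℤ; ∣_∣; _◃_; -_; _*_)
open import Data.List.Base using (List; map; allFin; filter; length)
open import Data.List.Extrema.Nat using (max)
open import Data.Nat.Base as ℕ using (ℕ; suc; _≤_; s≤s)
import Data.Nat.Properties as ℕ
open import Data.Product.Base using (∃; _×_; _,_)
open import Data.Product.Function.NonDependent.Propositional using (_×-↔_)
open import Data.Sign.Base using (Sign)
open import Data.Sum.Base using (_⊎_; inj₁; inj₂; swap)
open import Function.Bundles using (_↔_; Inverse)
open import Function.Properties.Inverse using (↔-refl; ↔-sym; ↔-trans; ↔⇒↣)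
open import Axiom.UniquenessOfIdentityProofs using (module Decidable⇒UIP)
open import Level using (0ℓ)
open import Relation.Binary.Core using (Rel)
open import Relation.Binary.Definitions
  using (Decidable; DecidableEquality; Irreflexive; Irrelevant; Symmetric)
open import Relation.Binary.PropositionalEquality.Core
  using (_≡_; _≢_; refl; sym; trans; cong; cong₂)
open import Relation.Nullary using (¬_)
import Relation.Nullary as Nullary
open import Relation.Nullary.Decidable using (_×-dec_; _⊎-dec_; via-injection)
open import Relation.Unary using (Pred)

-- Finite simple graphs.  Since Adj is proof-irrelevant, the type Adj u v
-- has at most one element; an element of it serves both as the edge uv and
-- as the incidence u:uv, so that the elements of ∃₂ Adj are exactly the
-- incidences of the graph, without repetition.
record Graph : Set₁ where
  field
    V              : Set
    order          : ℕ
    finite         : V ↔ Fin order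
    Adj            : Rel V 0ℓ
    Adj?           : Decidable Adj
    Adj-irrelevant : Irrelevant Adj
    Adj-sym        : Symmetric Adj
    Adj-irrefl     : Irreflexive _≡_ Adj

  _≟_ : DecidableEquality V
  _≟_ = via-injection (↔⇒↣ finite) Fin._≟_

  vertices : List V
  vertices = map (Inverse.from finite) (allFin order)

  degree : V → ℕ
  degree v = length (filter (Adj? v) vertices)

  maxDegree : ℕ
  maxDegree = max 0 (map degree vertices)

record Signature (G : Graph) : Set where
  open Graph G
  field
    σ     : ∀ {u v} → Adj u v → Sign
    σ-sym : ∀ {u v} (e : Adj u v) → σ (Adj-sym e) ≡ σ e

record SignedGraph : Set₁ where
  constructor ⟨_,_⟩
  field
    graph     : Graph
    signature : Signature graph
  open Graph graph public
  open Signature signature public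

Δ : SignedGraph → ℕ
Δ = SignedGraph.maxDegree

M : ℕ → Pred ℤ 0ℓ
M k z = (∃ λ l → k ≡ suc (2 ℕ.* l) × ∣ z ∣ ≤ l)
      ⊎ (∃ λ l → k ≡ 2 ℕ.* l × 1 ≤ ∣ z ∣ × ∣ z ∣ ≤ l)

-- For e : Adj u v, the colour of the incidence u:uv is f e and that of v:uv
-- is f (Adj-sym e).
record EdgeColoring (S : SignedGraph) (k : ℕ) : Set where
  open SignedGraph S
  field
    f        : ∀ {u v} → Adj u v → ℤ
    f∈M      : ∀ {u v} (e : Adj u v) → M k (f e)
    f-signed : ∀ {u v} (e : Adj u v) → f e ≡ - (σ e ◃ 1) * f (Adj-sym e)
    f-proper : ∀ {u v₁ v₂} (e₁ : Adj u v₁) (e₂ : Adj u v₂) →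
               v₁ ≢ v₂ → f e₁ ≢ f e₂

record IsChromaticIndex (S : SignedGraph) (k : ℕ) : Set where
  field
    positive : 1 ≤ k
    coloring : EdgeColoring S k
    minimal  : ∀ j → 1 ≤ j → EdgeColoring S j → k ≤ j

⊎-irrelevant : ∀ {A B : Set} → Nullary.Irrelevant A → Nullary.Irrelevant B →
               ¬ (A × B) → Nullary.Irrelevant (A ⊎ B)
⊎-irrelevant irrA irrB ¬ab (inj₁ a) (inj₁ a′) = cong inj₁ (irrA a a′)
⊎-irrelevant irrA irrB ¬ab (inj₁ a) (inj₂ b)  = ⊥-elim (¬ab (a , b))
⊎-irrelevant irrA irrB ¬ab (inj₂ b) (inj₁ a)  = ⊥-elim (¬ab (a , b))
⊎-irrelevant irrA irrB ¬ab (inj₂ b) (inj₂ b′) = cong inj₂ (irrB b b′)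

×-irrelevant : ∀ {A B : Set} → Nullary.Irrelevant A → Nullary.Irrelevant B →
               Nullary.Irrelevant (A × B)
×-irrelevant irrA irrB (a , b) (a′ , b′) = cong₂ _,_ (irrA a a′) (irrB b b′)

module _ (r : ℕ) where

  PathAdj : Rel (Fin r) 0ℓ
  PathAdj i j = toℕ j ≡ suc (toℕ i) ⊎ toℕ i ≡ suc (toℕ j)

  path : Graph
  path = record
    { V              = Fin r
    ; order          = r
    ; finite         = ↔-refl
    ; Adj            = PathAdj
    ; Adj?           = λ i j → (toℕ j ℕ.≟ suc (toℕ i)) ⊎-dec (toℕ i ℕ.≟ suc (toℕ j))
    ; Adj-irrelevant = ⊎-irrelevant ℕ.≡-irrelevant ℕ.≡-irrelevant
        (λ (p , q) → ℕ.m≢1+n+m _ (trans p (cong suc q)))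
    ; Adj-sym        = swap
    ; Adj-irrefl     = λ { refl (inj₁ p) → ℕ.m≢1+m+n _ (trans p (cong suc (sym (ℕ.+-identityʳ _))))
                         ; refl (inj₂ p) → ℕ.m≢1+m+n _ (trans p (cong suc (sym (ℕ.+-identityʳ _)))) }
    }

-- CyclicSuc s i j: j ≡ i + 1 modulo s, for representatives i, j < s.
CyclicSuc : (s : ℕ) → Rel ℕ 0ℓ
CyclicSuc s i j = j ≡ suc i ⊎ (j ≡ 0 × suc i ≡ s)

cyclicSuc? : ∀ s → Decidable (CyclicSuc s)
cyclicSuc? s i j = (j ℕ.≟ suc i) ⊎-dec ((j ℕ.≟ 0) ×-dec (suc i ℕ.≟ s))

cyclicSuc-irrelevant : ∀ s → Irrelevant (CyclicSuc s)
cyclicSuc-irrelevant s = ⊎-irrelevant ℕ.≡-irrelevant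
  (×-irrelevant ℕ.≡-irrelevant ℕ.≡-irrelevant) (λ { (refl , () , _) })

cyclicSuc-irrefl : ∀ {s i} → 3 ≤ s → ¬ CyclicSuc s i i
cyclicSuc-irrefl _        (inj₁ p)             = ℕ.1+n≢n (sym p)
cyclicSuc-irrefl (s≤s ()) (inj₂ (refl , refl))

cyclicSuc-asym : ∀ {s i j} → 3 ≤ s → ¬ (CyclicSuc s i j × CyclicSuc s j i)
cyclicSuc-asym _              (inj₁ p             , inj₁ q)             = ℕ.m≢1+n+m _ (trans p (cong suc q))
cyclicSuc-asym (s≤s (s≤s ())) (inj₁ refl          , inj₂ (refl , refl))
cyclicSuc-asym (s≤s (s≤s ())) (inj₂ (refl , refl) , inj₁ refl)

module _ (s : ℕ) (3≤s : 3 ≤ s) where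

  CycleAdj : Rel (Fin s) 0ℓ
  CycleAdj i j = CyclicSuc s (toℕ i) (toℕ j) ⊎ CyclicSuc s (toℕ j) (toℕ i)

  cycle : Graph
  cycle = record
    { V              = Fin s
    ; order          = s
    ; finite         = ↔-refl
    ; Adj            = CycleAdj
    ; Adj?           = λ i j → cyclicSuc? s (toℕ i) (toℕ j) ⊎-dec cyclicSuc? s (toℕ j) (toℕ i)
    ; Adj-irrelevant = ⊎-irrelevant (cyclicSuc-irrelevant s) (cyclicSuc-irrelevant s)
        (cyclicSuc-asym 3≤s)
    ; Adj-sym        = swap
    ; Adj-irrefl     = λ { refl (inj₁ p) → cyclicSuc-irrefl 3≤s p
                         ; refl (inj₂ p) → cyclicSuc-irrefl 3≤s p }
    }

module _ (G₁ G₂ : Graph) where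
  private
    module G₁ = Graph G₁
    module G₂ = Graph G₂

  ProductAdj : Rel (G₁.V × G₂.V) 0ℓ
  ProductAdj (u , u′) (v , v′) = (u ≡ v × G₂.Adj u′ v′) ⊎ (G₁.Adj u v × u′ ≡ v′)

  productGraph : Graph
  productGraph = record
    { V              = G₁.V × G₂.V
    ; order          = G₁.order ℕ.* G₂.order
    ; finite         = ↔-trans (G₁.finite ×-↔ G₂.finite) (↔-sym Fin.*↔×)
    ; Adj            = ProductAdj
    ; Adj?           = λ (u , u′) (v , v′) →
        ((u G₁.≟ v) ×-dec G₂.Adj? u′ v′) ⊎-dec (G₁.Adj? u v ×-dec (u′ G₂.≟ v′))
    ; Adj-irrelevant = ⊎-irrelevant
        (×-irrelevant (Decidable⇒UIP.≡-irrelevant G₁._≟_) G₂.Adj-irrelevant)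
        (×-irrelevant G₁.Adj-irrelevant (Decidable⇒UIP.≡-irrelevant G₂._≟_))
        (λ ((p , _) , (a , _)) → G₁.Adj-irrefl p a)
    ; Adj-sym        = λ { (inj₁ (p , a)) → inj₁ (sym p , G₂.Adj-sym a)
                         ; (inj₂ (a , p)) → inj₂ (G₁.Adj-sym a , sym p) }
    ; Adj-irrefl     = λ { refl (inj₁ (_ , a)) → G₂.Adj-irrefl refl a
                         ; refl (inj₂ (a , _)) → G₁.Adj-irrefl refl a }
    }

infixr 6 _□_

_□_ : SignedGraph → SignedGraph → SignedGraph
S₁ □ S₂ = ⟨ productGraph S₁.graph S₂.graph , record
  { σ     = λ { (inj₁ (_ , e)) → S₂.σ e
              ; (inj₂ (e , _)) → S₁.σ e }
  ; σ-sym = λ { (inj₁ (_ , e)) → S₂.σ-sym e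
              ; (inj₂ (e , _)) → S₁.σ-sym e }
  } ⟩
  where
    module S₁ = SignedGraph S₁
    module S₂ = SignedGraph S₂

{-# OPTIONS --safe #-}
module Submission where

-- Pair the rows of the grid as (0,1), (2,3), ….  Class A, coloured ±1, joins
-- each pair of rows into the Hamiltonian cycle of the pair that avoids the
-- wrapping edges (an unpaired last row contributes a path).  The remaining
-- edges form class B, whose only cycles are 4-cycles on two wrapping and two
-- vertical edges.  All these cycles are balanced, because all copies of a
-- factor's edge carry the same sign, so B can be coloured ±2; when r = 2,
-- class B is a matching and is coloured 0.  Conversely, the colours at a
-- vertex are distinct elements of M k, whence Δ ≤ k.

open import Defs
open import Data.Bool.Base using (true; false; if_then_else_)
open import Data.Fin.Base using (Fin; zero; suc; toℕ; fromℕ; fromℕ<)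
import Data.Fin.Properties as Fin
open import Data.Integer.Base as ℤ using (ℤ; ∣_∣; -[1+_]; _◃_)
import Data.Integer.Properties as ℤ
open import Data.List.Base using (List; []; _∷_; map; filter; lookup; length)
open import Data.List.Extrema.Nat using (max≤v⁺; xs≤max)
open import Data.List.Membership.Propositional using (_∈_)
open import Data.List.Membership.Propositional.Properties
  using (∈-lookup; ∈-allFin; ∈-map⁺; ∈-filter⁺; ∈-filter⁻)
open import Data.List.Relation.Unary.All as All using (All; []; _∷_)
import Data.List.Relation.Unary.All.Properties as All
open import Data.List.Relation.Unary.AllPairs using ([]; _∷_)
open import Data.List.Relation.Unary.Any using (index)
open import Data.List.Relation.Unary.Any.Properties using (lookup-index)
open import Data.List.Relation.Unary.Unique.Propositional using (Unique)
import Data.List.Relation.Unary.Unique.Propositional.Properties as Unique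
open import Data.Nat.Base as ℕ using (ℕ; zero; suc; pred; parity; _≤_; _<_; _>_; z≤n; s≤s)
import Data.Nat.Properties as ℕ
open import Data.Parity.Base using (Parity; 0ℙ; 1ℙ)
open import Data.Parity.Properties using (p≢p⁻¹; suc-homo-⁻¹)
open import Data.Product.Base using (∃; _×_; _,_; proj₁; proj₂)
open import Data.Sign.Base using (Sign; +; -; _*_; opposite)
import Data.Sign.Properties as Sign
open import Data.Sum.Base using (_⊎_; inj₁; inj₂)
open import Function.Bundles using (Inverse; Injection)
open import Function.Definitions using (Injective)
open import Function.Properties.Inverse using (↔-sym; ↔⇒↣)
open import Relation.Binary.PropositionalEquality
open import Relation.Nullary using (yes; no; does; contradiction)
open import Relation.Nullary.Decidable using (dec-true; dec-false)
open import Algebra.Solver.CommutativeMonoid Sign.*-commutativeMonoid using (solve; _⊜_; _⊕_)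

-- Lists without repetition and an enumeration of the colours.

lookup-injective : ∀ {A : Set} {xs : List A} → Unique xs → Injective _≡_ _≡_ (lookup xs)
lookup-injective (_ ∷ _)    {zero}  {zero}  _  = refl
lookup-injective (x∉ ∷ _)   {zero}  {suc j} eq = contradiction eq (All.lookup x∉ (∈-lookup j))
lookup-injective (x∉ ∷ _)   {suc i} {zero}  eq = contradiction (sym eq) (All.lookup x∉ (∈-lookup i))
lookup-injective (_ ∷ uniq) {suc i} {suc j} eq = cong suc (lookup-injective uniq eq)

-- Lists the integers as 0, -1, 1, -2, 2, ..., so that those of absolute value at most l fill
-- exactly the ranks 0 to 2l.
rank : ℤ → ℕ
rank (ℤ.+ n)  = 2 ℕ.* n
rank -[1+ n ] = suc (2 ℕ.* n)

rank-injective : Injective _≡_ _≡_ rank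
rank-injective {ℤ.+ m}     {ℤ.+ n}     eq = cong ℤ.+_ (ℕ.*-cancelˡ-≡ m n 2 eq)
rank-injective {ℤ.+ m}     { -[1+ n ]} eq = contradiction eq (ℕ.even≢odd m n)
rank-injective { -[1+ m ]} {ℤ.+ n}     eq = contradiction (sym eq) (ℕ.even≢odd n m)
rank-injective { -[1+ m ]} { -[1+ n ]} eq = cong -[1+_] (ℕ.*-cancelˡ-≡ m n 2 (ℕ.suc-injective eq))

rank≤2∣z∣ : ∀ z → rank z ≤ 2 ℕ.* ∣ z ∣
rank≤2∣z∣ (ℤ.+ n)  = ℕ.≤-refl
rank≤2∣z∣ -[1+ n ] = ℕ.≤-trans (ℕ.n≤1+n _) (ℕ.≤-reflexive (sym (ℕ.*-suc 2 n)))

rank>0 : ∀ z → 1 ≤ ∣ z ∣ → 1 ≤ rank z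
rank>0 (ℤ.+ suc n) _ = s≤s z≤n
rank>0 -[1+ n ]    _ = s≤s z≤n

-- For even k the value 0 of rank, taken only at the colour 0, is not used.
position : ∀ k z → M k z → ℕ
position k z (inj₁ _) = rank z
position k z (inj₂ _) = pred (rank z)

position< : ∀ {k} z (m : M k z) → position k z m < k
position< z (inj₁ (l , refl , z≤l)) =
  s≤s (ℕ.≤-trans (rank≤2∣z∣ z) (ℕ.*-monoʳ-≤ 2 z≤l))
position< z (inj₂ (l , refl , 1≤z , z≤l)) =
  ℕ.<-≤-trans (ℕ.≤-reflexive (ℕ.suc-pred (rank z) {{ℕ.>-nonZero (rank>0 z 1≤z)}}))
    (ℕ.≤-trans (rank≤2∣z∣ z) (ℕ.*-monoʳ-≤ 2 z≤l))

-- The mixed cases cannot occur: they would make `k` both even and odd.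
position-injective : ∀ {k} y z (m : M k y) (n : M k z) → position k y m ≡ position k z n → y ≡ z
position-injective y z (inj₁ _) (inj₁ _) eq = rank-injective eq
position-injective y z (inj₁ (l , p , _)) (inj₂ (l′ , q , _)) _ =
  contradiction (trans (sym q) p) (ℕ.even≢odd l′ l)
position-injective y z (inj₂ (l , p , _)) (inj₁ (l′ , q , _)) _ =
  contradiction (trans (sym p) q) (ℕ.even≢odd l l′)
position-injective y z (inj₂ (_ , _ , 1≤y , _)) (inj₂ (_ , _ , 1≤z , _)) eq =
  rank-injective (ℕ.pred-injective {{ℕ.>-nonZero (rank>0 y 1≤y)}} {{ℕ.>-nonZero (rank>0 z 1≤z)}} eq)

-- Degrees and neighbour lists.

module _ (G : Graph) where
  open Graph G

  vertices-unique : Unique vertices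
  vertices-unique = Unique.map⁺ (Injection.injective (↔⇒↣ (↔-sym finite))) (Unique.allFin⁺ order)

  ∈-vertices : ∀ v → v ∈ vertices
  ∈-vertices v = subst (_∈ vertices) (Inverse.strictlyInverseʳ finite v)
    (∈-map⁺ (Inverse.from finite) (∈-allFin (Inverse.to finite v)))

  neighbours : V → List V
  neighbours v = filter (Adj? v) vertices

  -- Sending each listed vertex to its index among the neighbours of `v` is injective. Exhibiting
  -- neighbours thus bounds Δ from below.
  unique⇒≤degree : ∀ {us} v → Unique us → All (Adj v) us → length us ≤ degree v
  unique⇒≤degree {us} v unique adj = Fin.injective⇒≤ {f = λ i → index (nbr i)} λ {i} {j} eq →
    lookup-injective unique (trans (lookup-index (nbr i))
      (trans (cong (lookup (neighbours v)) eq) (sym (lookup-index (nbr j)))))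
    where
    nbr : ∀ i → lookup us i ∈ neighbours v
    nbr i = ∈-filter⁺ (Adj? v) (∈-vertices (lookup us i)) (All.lookup adj (∈-lookup i))

  degree≤maxDegree : ∀ v → degree v ≤ maxDegree
  degree≤maxDegree v = All.lookup (xs≤max 0 (map degree vertices)) (∈-map⁺ degree (∈-vertices v))

  maxDegree≤ : ∀ {k} → (∀ v → degree v ≤ k) → maxDegree ≤ k
  maxDegree≤ h = max≤v⁺ z≤n (All.map⁺ (All.tabulate {xs = vertices} λ {v} _ → h v))

-- The lower bound on the number of colours.

module _ (S : SignedGraph) where
  open SignedGraph S

  coloring⇒Δ≤ : ∀ {k} → EdgeColoring S k → Δ S ≤ k
  coloring⇒Δ≤ {k} c = maxDegree≤ graph λ v → Fin.injective⇒≤ (colour-injective v)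
    where
    open EdgeColoring c

    nbr : ∀ v → Fin (degree v) → V
    nbr v = lookup (neighbours graph v)

    edge : ∀ v i → Adj v (nbr v i)
    edge v i = proj₂ (∈-filter⁻ (Adj? v) {xs = vertices} (∈-lookup i))

    colour : ∀ v → Fin (degree v) → Fin k
    colour v i = fromℕ< (position< (f (edge v i)) (f∈M (edge v i)))

    colour-injective : ∀ v → Injective _≡_ _≡_ (colour v)
    -- `f-proper` separates only distinct neighbours; if the neighbours coincide, so do the indices,
    -- because the neighbour list has no repetition.
    colour-injective v {i} {j} eq with nbr v i ≟ nbr v j
    ... | yes same = lookup-injective (Unique.filter⁺ (Adj? v) (vertices-unique graph)) same
    ... | no  diff = contradiction
      (position-injective _ _ (f∈M (edge v i)) (f∈M (edge v j)) (Fin.fromℕ<-injective _ _ _ _ eq))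
      (f-proper (edge v i) (edge v j) diff)

  -- The given colouring itself yields `Δ S ≤ k`, so Δ need only be bounded from below and is never
  -- computed directly.
  coloring⇒IsChromaticIndex : ∀ {k} → 1 ≤ k → EdgeColoring S k → k ≤ Δ S → IsChromaticIndex S (Δ S)
  coloring⇒IsChromaticIndex 1≤k c k≤Δ = record
    { positive = ℕ.≤-trans 1≤k k≤Δ
    ; coloring = subst (EdgeColoring S) (ℕ.≤-antisym k≤Δ (coloring⇒Δ≤ c)) c
    ; minimal  = λ _ _ → coloring⇒Δ≤
    }

-- Switching on a path.

-- Every signature on a path is switching equivalent to the all-positive one.
potential : ∀ n (t : ∀ {i j : Fin n} → toℕ j ≡ suc (toℕ i) → Sign) →
            ∃ λ (ρ : Fin n → Sign) → ∀ {i j} (p : toℕ j ≡ suc (toℕ i)) → t p ≡ ρ i * ρ j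
potential zero          t = (λ ()) , λ {i} → contradiction i Fin.¬Fin0
potential (suc zero)    t = (λ _ → +) , λ { {zero} {zero} () }
potential (suc (suc n)) t with potential (suc n) (λ p → t (cong suc p))
... | ρ , tρ = ρ⁺ , tρ⁺
  where
  ρ⁺ : Fin (suc (suc n)) → Sign
  ρ⁺ zero    = t {zero} {suc zero} refl * ρ zero
  ρ⁺ (suc i) = ρ i

  tρ⁺ : ∀ {i j} (p : toℕ j ≡ suc (toℕ i)) → t p ≡ ρ⁺ i * ρ⁺ j
  tρ⁺ {i}     {zero}        ()
  tρ⁺ {zero}  {suc zero}    p = begin
    t p                          ≡⟨ cong t (ℕ.≡-irrelevant p refl) ⟩
    t refl                       ≡⟨ Sign.*-identityʳ (t refl) ⟨
    t refl * +                   ≡⟨ cong (t refl *_) (Sign.s*s≡+ (ρ zero)) ⟨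
    t refl * (ρ zero * ρ zero)   ≡⟨ Sign.*-assoc (t refl) (ρ zero) (ρ zero) ⟨
    t refl * ρ zero * ρ zero     ∎
    where open ≡-Reasoning
  tρ⁺ {zero}  {suc (suc j)} ()
  tρ⁺ {suc i} {suc j}       p =
    trans (cong t (ℕ.≡-irrelevant p (cong suc (ℕ.suc-injective p)))) (tρ (ℕ.suc-injective p))

-- The local pattern of classes and signs.

data Column : Set where
  first middle last : Column

-- The outer columns are singled out because there the left or the right port is a wrapping edge.
-- Columns count from 0, so `suc j` is the last when `suc (suc j)` equals `s`.
column : ℕ → ℕ → Column
column s zero    = first
column s (suc j) = if does (suc (suc j) ℕ.≟ s) then last else middle

-- The vertical edges between rows i and i + 1 have rung (parity i).
data Port : Set where
  left right : Port
  rung       : Parity → Port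

rungParity : ∀ {r} (i j : Fin r) → PathAdj r i j → Parity
rungParity i j (inj₁ _) = parity (toℕ i)
rungParity i j (inj₂ _) = parity (toℕ j)

parity-alternates : ∀ {i j} → i ≡ suc j → parity i ≢ parity j
parity-alternates {j = j} refl eq = p≢p⁻¹ (parity (suc j)) (trans eq (sym (suc-homo-⁻¹ j)))

-- The edges from a row to the next and to the previous row carry the parities of consecutive
-- numbers, which differ.
rungParity-injective : ∀ {r} {i j k : Fin r} (d : PathAdj r i j) (e : PathAdj r i k) →
                       rungParity i j d ≡ rungParity i k e → j ≡ k
rungParity-injective (inj₁ p) (inj₁ q) _  = Fin.toℕ-injective (trans p (sym q))
rungParity-injective (inj₁ _) (inj₂ q) eq = contradiction eq (parity-alternates q)
rungParity-injective (inj₂ p) (inj₁ _) eq = contradiction (sym eq) (parity-alternates p)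
rungParity-injective (inj₂ p) (inj₂ q) _  = Fin.toℕ-injective (ℕ.suc-injective (trans (sym p) q))

rung-injective : ∀ {p q} → rung p ≡ rung q → p ≡ q
rung-injective refl = refl

data Class : Set where
  A B : Class

-- The signs of the incidences after switching every non-wrapping horizontal
-- edge to + and every vertical edge to -; w is the switched sign of the
-- wrapping edges.
code : Sign → Column → Port → Class × Sign
code w first  left      = B , +
code w first  right     = A , +
code w first  (rung 0ℙ) = A , -
code w first  (rung 1ℙ) = B , -
code w middle left      = A , -
code w middle right     = A , +
code w middle (rung 0ℙ) = B , +
code w middle (rung 1ℙ) = B , -
code w last   left      = A , -
code w last   right     = B , opposite w
code w last   (rung 0ℙ) = A , +
code w last   (rung 1ℙ) = B , w

-- A left inverse of `code w c`, so that injectivity is checked port by port instead of for all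
-- pairs of ports. In the last column both class B signs depend on `w`, hence the comparison.
port : Sign → Column → Class × Sign → Port
port w first  (A , +) = right
port w first  (A , -) = rung 0ℙ
port w first  (B , +) = left
port w first  (B , -) = rung 1ℙ
port w middle (A , +) = right
port w middle (A , -) = left
port w middle (B , +) = rung 0ℙ
port w middle (B , -) = rung 1ℙ
port w last   (A , +) = rung 0ℙ
port w last   (A , -) = left
port w last   (B , t) = if does (t Sign.≟ w) then rung 1ℙ else right

port-code : ∀ w c d → port w c (code w c d) ≡ d
port-code w first  left      = refl
port-code w first  right     = refl
port-code w first  (rung 0ℙ) = refl
port-code w first  (rung 1ℙ) = refl
port-code w middle left      = refl
port-code w middle right     = refl
port-code w middle (rung 0ℙ) = refl
port-code w middle (rung 1ℙ) = refl
port-code w last   left      = refl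
port-code - last   right     = refl
port-code + last   right     = refl
port-code w last   (rung 0ℙ) = refl
port-code - last   (rung 1ℙ) = refl
port-code + last   (rung 1ℙ) = refl

code-injective : ∀ w c → Injective _≡_ _≡_ (code w c)
code-injective w c eq = trans (sym (port-code w c _)) (trans (cong (port w c) eq) (port-code w c _))

B-port : Column → Port
B-port first  = left
B-port middle = rung 0ℙ
B-port last   = right

-- Class B has two ports in each column, one being `rung 1ℙ`. Without that rung it is a matching,
-- and the single colour 0, which satisfies the sign rule on every edge, suffices for it.
B-unique : ∀ w c d → proj₁ (code w c d) ≡ B → d ≢ rung 1ℙ → d ≡ B-port c
B-unique w first  left      _ _ = refl
B-unique w middle (rung 0ℙ) _ _ = refl
B-unique w last   right     _ _ = refl
B-unique w c      (rung 1ℙ) _ d≢rung = contradiction refl d≢rung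

code-right : ∀ {w s j} → suc j < s → code w (column s j) right ≡ (A , +)
code-right {j = zero}      j<s = refl
code-right {s = s} {suc j} j<s rewrite dec-false (suc (suc j) ℕ.≟ s) (ℕ.<⇒≢ j<s) = refl

code-left : ∀ {w s i j} → j ≡ suc i → code w (column s j) left ≡ (A , -)
code-left {s = s} {i} refl with does (suc (suc i) ℕ.≟ s)
... | true  = refl
... | false = refl

code-wrap-left : ∀ {w s j} → j ≡ 0 → code w (column s j) left ≡ (B , +)
code-wrap-left refl = refl

-- `2 ≤ s` keeps the final column apart from column 0, which `column` always calls `first`.
code-wrap-right : ∀ {w s j} → 2 ≤ s → suc j ≡ s → code w (column s j) right ≡ (B , opposite w)
code-wrap-right {j = zero}  (s≤s ()) refl
code-wrap-right {s = s} {suc j} _ eq rewrite dec-true (suc (suc j) ℕ.≟ s) eq = refl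

-- From switched signs to colours.

square-cancels : ∀ x y → x * x * y ≡ y
square-cancels x y = cong (_* y) (Sign.s*s≡+ x)

-- Undoes the switching: with switching signs `x` and `y` at its ends, an edge of switched sign `w`
-- has original sign `x * (w * y)`. The extra factor `y` squares to `+`.
switch : ∀ x y w t → x * (opposite w * t) ≡ opposite (x * (w * y)) * (y * t)
switch x y w t = begin
  x * (- * w * t)              ≡⟨ square-cancels y _ ⟨
  y * y * (x * (- * w * t))    ≡⟨ solve 5 (λ x y w t n →
    (y ⊕ y) ⊕ (x ⊕ ((n ⊕ w) ⊕ t)) ⊜ (n ⊕ (x ⊕ (w ⊕ y))) ⊕ (y ⊕ t)) refl x y w t - ⟩
  - * (x * (w * y)) * (y * t)  ∎
  where open ≡-Reasoning

-- Meant for horizontal edges, where `c` is the row sign common to both ends and therefore cancels.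
shift : ∀ c x w y → x * (w * y) ≡ c * x * (w * (c * y))
shift c x w y = begin
  x * (w * y)              ≡⟨ square-cancels c _ ⟨
  c * c * (x * (w * y))    ≡⟨ solve 4 (λ c x w y →
    (c ⊕ c) ⊕ (x ⊕ (w ⊕ y)) ⊜ (c ⊕ x) ⊕ (w ⊕ (c ⊕ y))) refl c x w y ⟩
  c * x * (w * (c * y))    ∎
  where open ≡-Reasoning

-- `b` is the absolute value of the class B colours: 2 gives the palette `M 4`, and 0 gives `M 3`.
weight : ℕ → Class → ℕ
weight b A = 1
weight b B = b

paint : ℕ → Sign → Class × Sign → ℤ
paint b x (c , t) = x * t ◃ weight b c

-- Both ends of an edge have the same class, hence the same absolute value; the signs are settled by
-- `switch`.
paint-signed : ∀ b x y w {σ p q c t u} → σ ≡ x * (w * y) → p ≡ (c , t) → q ≡ (c , u) →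
               t ≡ opposite w * u → paint b x p ≡ ℤ.- (σ ◃ 1) ℤ.* paint b y q
paint-signed b x y w {σ} {c = c} {t} {u} refl refl refl refl = begin
  x * t ◃ n                         ≡⟨ cong (_◃ n) (switch x y w u) ⟩
  opposite σ * (y * u) ◃ n          ≡⟨ cong (opposite σ * (y * u) ◃_) (ℕ.*-identityˡ n) ⟨
  opposite σ * (y * u) ◃ 1 ℕ.* n    ≡⟨ ℤ.◃-distrib-* (opposite σ) (y * u) 1 n ⟩
  (opposite σ ◃ 1) ℤ.* (y * u ◃ n)  ≡⟨ cong (ℤ._* (y * u ◃ n)) (neg σ) ⟨
  ℤ.- (σ ◃ 1) ℤ.* (y * u ◃ n)       ∎
  where
  open ≡-Reasoning
  n = weight b c
  neg : ∀ a → ℤ.- (a ◃ 1) ≡ opposite a ◃ 1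
  neg + = refl
  neg - = refl

paint₂-injective : ∀ x → Injective _≡_ _≡_ (paint 2 x)
paint₂-injective x {A , t} {A , u} eq = cong (A ,_) (Sign.*-cancelˡ-≡ x t u (ℤ.sign-cong eq))
paint₂-injective x {B , t} {B , u} eq = cong (B ,_) (Sign.*-cancelˡ-≡ x t u (ℤ.sign-cong eq))
paint₂-injective x {A , t} {B , u} eq = contradiction (ℤ.abs-cong {x * t} {1} {x * u} {2} eq) λ ()
paint₂-injective x {B , t} {A , u} eq = contradiction (ℤ.abs-cong {x * t} {2} {x * u} {1} eq) λ ()

paint₀-injective : ∀ x {ct du} → paint 0 x ct ≡ paint 0 x du →
                   ct ≡ du ⊎ (proj₁ ct ≡ B × proj₁ du ≡ B)
paint₀-injective x {A , t} {A , u} eq = inj₁ (cong (A ,_) (Sign.*-cancelˡ-≡ x t u (ℤ.sign-cong eq)))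
paint₀-injective x {B , t} {B , u} eq = inj₂ (refl , refl)
paint₀-injective x {A , t} {B , u} eq = contradiction (ℤ.abs-cong {x * t} {1} {x * u} {0} eq) λ ()
paint₀-injective x {B , t} {A , u} eq = contradiction (ℤ.abs-cong {x * t} {0} {x * u} {1} eq) λ ()

paint₂∈M₄ : ∀ x ct → M 4 (paint 2 x ct)
paint₂∈M₄ x (A , t) = inj₂ (2 , refl , ℕ.≤-reflexive (sym (ℤ.abs-◃ (x * t) 1))
                                     , ℕ.≤-trans (ℕ.≤-reflexive (ℤ.abs-◃ (x * t) 1)) (s≤s z≤n))
paint₂∈M₄ x (B , t) = inj₂ (2 , refl , subst (1 ≤_) (sym (ℤ.abs-◃ (x * t) 2)) (s≤s z≤n)
                                     , ℕ.≤-reflexive (ℤ.abs-◃ (x * t) 2))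

paint₀∈M₃ : ∀ x ct → M 3 (paint 0 x ct)
paint₀∈M₃ x (A , t) = inj₁ (1 , refl , ℕ.≤-reflexive (ℤ.abs-◃ (x * t) 1))
paint₀∈M₃ x (B , t) = inj₁ (1 , refl , z≤n)

-- The factor is 1 or -1, hence its own inverse. Each edge then needs checking in one direction
-- only.
signed-flip : ∀ σ {y z} → y ≡ ℤ.- (σ ◃ 1) ℤ.* z → z ≡ ℤ.- (σ ◃ 1) ℤ.* y
signed-flip + {z = z} refl = sym (begin
  ℤ.-1ℤ ℤ.* (ℤ.-1ℤ ℤ.* z)  ≡⟨ ℤ.-1*i≡-i _ ⟩
  ℤ.- (ℤ.-1ℤ ℤ.* z)        ≡⟨ cong (ℤ.-_) (ℤ.-1*i≡-i z) ⟩
  ℤ.- ℤ.- z                ≡⟨ ℤ.neg-involutive z ⟩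
  z                        ∎)
  where open ≡-Reasoning
signed-flip - {z = z} refl = sym (trans (ℤ.*-identityˡ _) (ℤ.*-identityˡ z))

-- The wrapping edge and cyclic successors.

wrap-sign : ∀ s (t : ∀ {i j : Fin s} → toℕ j ≡ 0 × suc (toℕ i) ≡ s → Sign) (τ : Fin s → Sign) →
            ∃ λ w → ∀ {i j} p → t {i} {j} p ≡ τ i * (w * τ j)
wrap-sign zero    t τ = + , λ {i} → contradiction i Fin.¬Fin0
-- The required equation solved for the switched sign at the only wrapping edge. When `τ` is the
-- potential of the other edges, this is the product of all signs around the cycle.
wrap-sign (suc n) t τ = τ (fromℕ n) * (t₀ * τ zero) , λ p → unwrap p (ends p)
  where
  p₀ : toℕ (zero {n}) ≡ 0 × suc (toℕ (fromℕ n)) ≡ suc n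
  p₀ = refl , cong suc (Fin.toℕ-fromℕ n)

  t₀ : Sign
  t₀ = t p₀

  ends : ∀ {i j : Fin (suc n)} → toℕ j ≡ 0 × suc (toℕ i) ≡ suc n → i ≡ fromℕ n × j ≡ zero
  ends (q , p) = Fin.toℕ-injective (trans (ℕ.suc-injective p) (sym (Fin.toℕ-fromℕ n)))
               , Fin.toℕ-injective q

  unwrap : ∀ {i j} p → i ≡ fromℕ n × j ≡ zero →
           t {i} {j} p ≡ τ i * (τ (fromℕ n) * (t₀ * τ zero) * τ j)
  unwrap p (refl , refl) = begin
    t p                             ≡⟨ cong t (×-irrelevant ℕ.≡-irrelevant ℕ.≡-irrelevant p p₀) ⟩
    t₀                              ≡⟨ square-cancels a t₀ ⟨
    a * a * t₀                      ≡⟨ square-cancels b _ ⟨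
    b * b * (a * a * t₀)            ≡⟨ solve 3 (λ a b t →
      (b ⊕ b) ⊕ ((a ⊕ a) ⊕ t) ⊜ a ⊕ ((a ⊕ (t ⊕ b)) ⊕ b)) refl a b t₀ ⟩
    a * (a * (t₀ * b) * b)          ∎
    where
    open ≡-Reasoning
    a = τ (fromℕ n)
    b = τ zero

-- Together with `cyclicSuc-injective`, this makes a vertex have at most one right and at most one
-- left neighbour.
cyclicSuc-functional : ∀ {s i j k} → j < s → k < s → CyclicSuc s i j → CyclicSuc s i k → j ≡ k
cyclicSuc-functional j<s k<s (inj₁ p)       (inj₁ q)       = trans p (sym q)
cyclicSuc-functional j<s k<s (inj₁ refl)    (inj₂ (_ , q)) = contradiction q (ℕ.<⇒≢ j<s)
cyclicSuc-functional j<s k<s (inj₂ (_ , p)) (inj₁ refl)    = contradiction p (ℕ.<⇒≢ k<s)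
cyclicSuc-functional j<s k<s (inj₂ (p , _)) (inj₂ (q , _)) = trans p (sym q)

cyclicSuc-injective : ∀ {s i j k} → CyclicSuc s i k → CyclicSuc s j k → i ≡ j
cyclicSuc-injective (inj₁ p)          (inj₁ q)          = ℕ.suc-injective (trans (sym p) q)
cyclicSuc-injective (inj₁ refl)       (inj₂ (() , _))
cyclicSuc-injective (inj₂ (refl , _)) (inj₁ ())
cyclicSuc-injective (inj₂ (_ , p))    (inj₂ (_ , q))    = ℕ.suc-injective (trans p (sym q))

-- Colouring the product.

module _ {r s : ℕ} {3≤s : 3 ≤ s}
         (σ₁ : Signature (path r)) (σ₂ : Signature (cycle s 3≤s)) where

  private
    S : SignedGraph
    S = ⟨ path r , σ₁ ⟩ □ ⟨ cycle s 3≤s , σ₂ ⟩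

    module P = Signature σ₁
    module C = Signature σ₂
    open SignedGraph S

    -- Negating the signs first makes every vertical edge switch to `-`, so that its two incidences
    -- need equal codes.
    rows : ∃ λ (ρ : Fin r → Sign) → ∀ {i j} p → opposite (P.σ (inj₁ p)) ≡ ρ i * ρ j
    rows = potential r (λ p → opposite (P.σ (inj₁ p)))

    columns : ∃ λ (τ : Fin s → Sign) → ∀ {i j} p → C.σ (inj₁ (inj₁ p)) ≡ τ i * τ j
    columns = potential s (λ p → C.σ (inj₁ (inj₁ p)))

    ρ = proj₁ rows
    τ = proj₁ columns

    wraps : ∃ λ w → ∀ {i j} p → C.σ (inj₁ (inj₂ p)) ≡ τ i * (w * τ j)
    wraps = wrap-sign s (λ p → C.σ (inj₁ (inj₂ p))) τ

    w = proj₁ wraps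

  -- All copies of a factor's edge carry one sign, so the product of the two potentials switches
  -- every copy at once.
  θ : V → Sign
  θ (i , j) = ρ i * τ j

  edgePort : ∀ {u v} → Adj u v → Port
  edgePort                 (inj₁ (_ , inj₁ _)) = right
  edgePort                 (inj₁ (_ , inj₂ _)) = left
  edgePort {i , _} {j , _} (inj₂ (e , _))      = rung (rungParity i j e)

  hue : ℕ → ∀ {u v} → Adj u v → ℤ
  hue b {u} e = paint b (θ u) (code w (column s (toℕ (proj₂ u))) (edgePort e))

  Signed : ℕ → ∀ {u v} → Adj u v → Set
  Signed b {u} {v} e = hue b e ≡ ℤ.- (σ e ◃ 1) ℤ.* hue b (Adj-sym e)

  hue-signed→ : ∀ b {i i′ j j′} (p : i ≡ i′) (q : CyclicSuc s (toℕ j) (toℕ j′)) →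
                Signed b {i , j} {i′ , j′} (inj₁ (p , inj₁ q))
  hue-signed→ b {i} {_} {j} {j′} refl (inj₁ q) =
    paint-signed b (θ (i , j)) (θ (i , j′)) +
      (trans (proj₂ columns q) (shift (ρ i) (τ j) + (τ j′)))
      (code-right (subst (_< s) q (Fin.toℕ<n j′))) (code-left q) refl
  hue-signed→ b {i} {_} {j} {j′} refl (inj₂ q) =
    paint-signed b (θ (i , j)) (θ (i , j′)) w
      (trans (proj₂ wraps q) (shift (ρ i) (τ j) w (τ j′)))
      (code-wrap-right (ℕ.≤-trans (s≤s (s≤s z≤n)) 3≤s) (proj₂ q)) (code-wrap-left (proj₁ q))
      (sym (Sign.*-identityʳ (opposite w)))

  -- Both ends lie in one column and see the edge as a rung of the same parity, so their codes
  -- coincide, as the switched sign `-` demands.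
  hue-signed↓ : ∀ b {i i′ j j′} (p : toℕ i′ ≡ suc (toℕ i)) (q : j ≡ j′) →
                Signed b {i , j} {i′ , j′} (inj₂ (inj₁ p , q))
  hue-signed↓ b {i} {i′} {j} p refl = paint-signed b (θ (i , j)) (θ (i′ , j)) - σ≡ refl refl refl
    where
    open ≡-Reasoning
    σ≡ : P.σ (inj₁ p) ≡ ρ i * τ j * (- * (ρ i′ * τ j))
    σ≡ = begin
      P.σ (inj₁ p)                          ≡⟨ Sign.opposite-involutive _ ⟨
      - * opposite (P.σ (inj₁ p))           ≡⟨ cong opposite (proj₂ rows p) ⟩
      - * (ρ i * ρ i′)                      ≡⟨ square-cancels (τ j) _ ⟨
      τ j * τ j * (- * (ρ i * ρ i′))        ≡⟨ solve 4 (λ a b t n →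
        (t ⊕ t) ⊕ (n ⊕ (a ⊕ b)) ⊜ (a ⊕ t) ⊕ (n ⊕ (b ⊕ t))) refl (ρ i) (ρ i′) (τ j) - ⟩
      ρ i * τ j * (- * (ρ i′ * τ j))        ∎

  Signed-sym : ∀ b {u v} (e : Adj u v) → Signed b e →
               hue b (Adj-sym e) ≡ ℤ.- (σ (Adj-sym e) ◃ 1) ℤ.* hue b e
  Signed-sym b e h = subst (λ a → hue b (Adj-sym e) ≡ ℤ.- (a ◃ 1) ℤ.* hue b e)
    (sym (σ-sym e)) (signed-flip (σ e) h)

  hue-signed : ∀ b {u v} (e : Adj u v) → Signed b e
  hue-signed b (inj₁ (p , inj₁ q))    = hue-signed→ b p q
  -- Matching on `refl` makes the edge definitionally the reverse of one already treated.
  hue-signed b (inj₁ (refl , inj₂ q)) = Signed-sym b (inj₁ (refl , inj₁ q)) (hue-signed→ b refl q)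
  hue-signed b (inj₂ (inj₁ p , q))    = hue-signed↓ b p q
  hue-signed b (inj₂ (inj₂ p , refl)) = Signed-sym b (inj₂ (inj₁ p , refl)) (hue-signed↓ b p refl)

  edgePort-injective : ∀ {u v₁ v₂} (e₁ : Adj u v₁) (e₂ : Adj u v₂) → edgePort e₁ ≡ edgePort e₂ → v₁ ≡ v₂
  edgePort-injective (inj₁ (refl , inj₁ p)) (inj₁ (refl , inj₁ q)) _ = cong (_ ,_)
    (Fin.toℕ-injective (cyclicSuc-functional (Fin.toℕ<n _) (Fin.toℕ<n _) p q))
  edgePort-injective (inj₁ (refl , inj₂ p)) (inj₁ (refl , inj₂ q)) _ = cong (_ ,_)
    (Fin.toℕ-injective (cyclicSuc-injective p q))
  edgePort-injective (inj₂ (d , refl)) (inj₂ (e , refl)) eq = cong (_, _)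
    (rungParity-injective d e (rung-injective eq))
  edgePort-injective (inj₁ (_ , inj₁ _)) (inj₂ _) ()
  edgePort-injective (inj₁ (_ , inj₂ _)) (inj₂ _) ()
  edgePort-injective (inj₂ _) (inj₁ (_ , inj₁ _)) ()
  edgePort-injective (inj₂ _) (inj₁ (_ , inj₂ _)) ()

  coloring₄ : EdgeColoring S 4
  coloring₄ = record
    { f        = hue 2
    ; f∈M      = λ {u} e → paint₂∈M₄ (θ u) (code w (column s (toℕ (proj₂ u))) (edgePort e))
    ; f-signed = hue-signed 2
    ; f-proper = λ {u} e₁ e₂ v₁≢v₂ eq → v₁≢v₂ (edgePort-injective e₁ e₂
        (code-injective w (column s (toℕ (proj₂ u))) (paint₂-injective (θ u) eq)))
    }

  coloring₃ : (∀ i j (e : PathAdj r i j) → rungParity i j e ≢ 1ℙ) → EdgeColoring S 3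
  coloring₃ rungs-even = record
    { f        = hue 0
    ; f∈M      = λ {u} e → paint₀∈M₃ (θ u) (code w (column s (toℕ (proj₂ u))) (edgePort e))
    ; f-signed = hue-signed 0
    ; f-proper = λ e₁ e₂ v₁≢v₂ eq → v₁≢v₂ (edgePort-injective e₁ e₂ (same-port e₁ e₂ eq))
    }
    where
    port≢rung1 : ∀ {u v} (e : Adj u v) → edgePort e ≢ rung 1ℙ
    port≢rung1 (inj₁ (_ , inj₁ _)) ()
    port≢rung1 (inj₁ (_ , inj₂ _)) ()
    port≢rung1 (inj₂ (e , _))      eq = rungs-even _ _ e (rung-injective eq)

    same-port : ∀ {u v₁ v₂} (e₁ : Adj u v₁) (e₂ : Adj u v₂) → hue 0 e₁ ≡ hue 0 e₂ →
                edgePort e₁ ≡ edgePort e₂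
    same-port {u} e₁ e₂ eq with paint₀-injective (θ u) eq
    ... | inj₁ same      = code-injective w (column s (toℕ (proj₂ u))) same
    -- Both edges have colour 0, so each leaves through the one remaining class B port of the
    -- column.
    ... | inj₂ (b₁ , b₂) = trans (B-unique w c _ b₁ (port≢rung1 e₁)) (sym (B-unique w c _ b₂ (port≢rung1 e₂)))
      where c = column s (toℕ (proj₂ u))

-- The maximum degree and the conclusion.

two-rows-even : ∀ i j (e : PathAdj 2 i j) → rungParity i j e ≢ 1ℙ
two-rows-even zero       j          (inj₁ _) ()
two-rows-even (suc zero) zero       (inj₁ ())
two-rows-even (suc zero) (suc zero) (inj₁ ())
two-rows-even i          zero       (inj₂ _) ()
two-rows-even zero       (suc zero) (inj₂ ())
two-rows-even (suc zero) (suc zero) (inj₂ ())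

3≤maxDegree : ∀ {n} 3≤s → 3 ≤ Graph.maxDegree (productGraph (path 2) (cycle (3 ℕ.+ n) 3≤s))
3≤maxDegree {n} 3≤s = ℕ.≤-trans
  (unique⇒≤degree G {(zero , zero) ∷ (zero , suc (suc zero)) ∷ (suc zero , suc zero) ∷ []}
    -- In column 1 both horizontal neighbours, in columns 0 and 2, are reached without wrapping.
    (zero , suc zero)
    (((λ ()) ∷ (λ ()) ∷ []) ∷ ((λ ()) ∷ []) ∷ [] ∷ [])
    (inj₁ (refl , inj₂ (inj₁ refl)) ∷ inj₁ (refl , inj₁ (inj₁ refl)) ∷ inj₂ (inj₁ refl , refl) ∷ []))
  (degree≤maxDegree G (zero , suc zero))
  where G = productGraph (path 2) (cycle (3 ℕ.+ n) 3≤s)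

4≤maxDegree : ∀ {m n} 3≤s →
              4 ≤ Graph.maxDegree (productGraph (path (3 ℕ.+ m)) (cycle (3 ℕ.+ n) 3≤s))
4≤maxDegree {m} {n} 3≤s = ℕ.≤-trans
  (unique⇒≤degree G
    {(suc zero , zero) ∷ (suc zero , suc (suc zero)) ∷ (zero , suc zero) ∷ (suc (suc zero) , suc zero) ∷ []}
    -- Row 1 is an inner row, since there are at least three rows.
    (suc zero , suc zero)
    (((λ ()) ∷ (λ ()) ∷ (λ ()) ∷ []) ∷ ((λ ()) ∷ (λ ()) ∷ []) ∷ ((λ ()) ∷ []) ∷ [] ∷ [])
    (inj₁ (refl , inj₂ (inj₁ refl)) ∷ inj₁ (refl , inj₁ (inj₁ refl)) ∷
     inj₂ (inj₂ refl , refl) ∷ inj₂ (inj₁ refl , refl) ∷ []))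
  (degree≤maxDegree G (suc zero , suc zero))
  where G = productGraph (path (3 ℕ.+ m)) (cycle (3 ℕ.+ n) 3≤s)

theorem8 : (r s : ℕ) (3≤s : 3 ≤ s)
    (σ₁ : Signature (path r)) (σ₂ : Signature (cycle s 3≤s)) →
    r > 1 →
    let S = ⟨ path r , σ₁ ⟩ □ ⟨ cycle s 3≤s , σ₂ ⟩
    in IsChromaticIndex S (Δ S)
theorem8 (suc zero) _ _ _ _ (s≤s ())
-- With two rows every rung is even and three colours suffice; from three rows on, an inner vertex
-- has four neighbours and four colours are used.
theorem8 (suc (suc zero)) (suc (suc (suc n))) 3≤s σ₁ σ₂ _ =
  coloring⇒IsChromaticIndex _ (s≤s z≤n) (coloring₃ {3≤s = 3≤s} σ₁ σ₂ two-rows-even) (3≤maxDegree 3≤s)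
theorem8 (suc (suc (suc m))) (suc (suc (suc n))) 3≤s σ₁ σ₂ _ =
  coloring⇒IsChromaticIndex _ (s≤s z≤n) (coloring₄ {3≤s = 3≤s} σ₁ σ₂) (4≤maxDegree 3≤s)
theorem8 (suc (suc _)) (suc zero)       (s≤s ())
theorem8 (suc (suc _)) (suc (suc zero)) (s≤s (s≤s ()))
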